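{- Let $T$ be an odd tree of order $n$, where $n\ge 4$. If $I$ is a nondecreasing distance-based topological index, then \[ I(T)\le I(T_n). \] If $I$ is a nonincreasing distance-based topological index, then \[ I(T)\ge I(T_n). \]
   Context: All graphs are finite and simple. The order of a graph is its number of vertices. An odd tree is a tree in which every vertex has odd degree; by the handshake lemma odd trees have even order. For even $n\ge 6$, $T_n$ denotes the tree obtained from the path $P_{n/2+1}$ on $n/2+1$ vertices by attaching one leaf to each internal vertex of the path; for $n=4$, $T_4$ is the star $S_4$ of order $4$. Thus $T_n$ is an odd tree of order $n$. For a connected graph $G$, $d_G(u,v)$ is the usual shortest-path distance. The distance sequence $\mathcal{D}(G)$ of a connected graph $G$ is the nondecreasing sequence (of length $\binom{n}{2}$ if $G$ has order $n$) of the distances between all unordered pairs of distinct vertices of $G$, with repetitions. A topological index $I$, assigning a real number to each connected graph, is distance-based if it can be expressed in the form $I(G)=g(\mathcal{D}(G))$, where $g$ is a real-valued function defined on the set of all finite sequences of positive integers. It is called nondecreasing (nonincreasing) if $g$, when restricted to sequences of any fixed length, is nondecreasing (nonincreasing) in every coordinate. -}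

module Defs where

open import Level using (0ℓ)
open import Data.Fin.Base using (Fin; toℕ; fromℕ<; inject)
open import Data.Fin.Properties as Fin using (any?; toℕ-fromℕ<; toℕ-inject; toℕ<n; toℕ-injective)
open import Data.Irrelevant using ([_])
open import Data.List.Base using (List; []; _∷_; _++_; _∷ʳ_; length; filter; map; concatMap; tabulate; allFin)
open import Data.List.Relation.Unary.Linked using (Linked)
open import Data.List.Relation.Unary.Unique.Propositional using (Unique)
import Data.List.Sort as Sort
open import Data.Nat.Base as ℕ using (ℕ; _+_; _*_; _∸_; _/_; _%_; _≤_; _<_; NonZero; z≤n; s≤s)
import Data.Nat.Properties as ℕ
open import Data.Product.Base using (∃; ∃₂; _×_; _,_; proj₁; proj₂)
open import Data.Rational.Base as ℚ using (ℚ)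
open import Data.Refinement using (Refinement-syntax; value; _,_)
open import Data.Sum.Base using (_⊎_; inj₁; inj₂; swap)
open import Function.Base using (_∘_)
open import Function.Bundles using (_⇔_)
open import Relation.Binary.Bundles using (DecTotalOrder)
open import Relation.Binary.Core using (Rel)
import Relation.Binary.Construct.On as On
import Relation.Binary.Definitions as B
open import Relation.Binary.PropositionalEquality.Core using (_≡_; _≢_; refl; sym; trans; cong; subst)
open import Relation.Nullary.Decidable using (Dec; yes; no; map′; _×-dec_; _⊎-dec_)
open import Relation.Nullary.Negation using (¬_; contradiction)
open import Relation.Unary using (Pred; Decidable)

------------------------------------------------------------------------
-- Real numbers

-- Two-sided Dedekind cuts of ℚ.  Equality of reals is _≃_, not _≡_.

record ℝ : Set₁ where
  field
    Lower Upper   : Pred ℚ 0ℓ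
    lower-inhab   : ∃ Lower
    upper-inhab   : ∃ Upper
    lower-rounded : ∀ q → Lower q ⇔ (∃ λ r → q ℚ.< r × Lower r)
    upper-rounded : ∀ q → Upper q ⇔ (∃ λ r → r ℚ.< q × Upper r)
    disjoint      : ∀ q → ¬ (Lower q × Upper q)
    located       : ∀ {q r} → q ℚ.< r → Lower q ⊎ Upper r

infix 4 _≤ᴿ_ _≃_

_≤ᴿ_ : Rel ℝ 0ℓ
x ≤ᴿ y = ∀ q → ℝ.Lower x q → ℝ.Lower y q

_≃_ : Rel ℝ 0ℓ
x ≃ y = x ≤ᴿ y × y ≤ᴿ x

------------------------------------------------------------------------
-- Positive integers

ℕ⁺ : Set
ℕ⁺ = [ n ∈ ℕ ∣ NonZero n ]

ℕ⁺-decTotalOrder : DecTotalOrder 0ℓ 0ℓ 0ℓ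
ℕ⁺-decTotalOrder = On.decTotalOrder ℕ.≤-decTotalOrder (value {P = NonZero})

------------------------------------------------------------------------
-- Finite simple graphs on the vertex set Fin n

record Graph (n : ℕ) : Set₁ where
  infix 4 _~_ _~?_
  field
    _~_    : Rel (Fin n) 0ℓ
    _~?_   : B.Decidable _~_
    ~-sym  : B.Symmetric _~_
    irrefl : ∀ {u} → ¬ (u ~ u)

module _ {n : ℕ} (G : Graph n) where
  open Graph G

  degree : Fin n → ℕ
  degree u = length (filter (u ~?_) (allFin n))

  data Walk : ℕ → Rel (Fin n) 0ℓ where
    []  : ∀ {u} → Walk 0 u u
    _∷_ : ∀ {k u v w} → u ~ v → Walk k v w → Walk (ℕ.suc k) u w

  Connected : Set
  Connected = ∀ u v → ∃ λ k → Walk k u v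

  record Cycle : Set where
    field
      first  : Fin n
      rest   : List (Fin n)
      long   : 2 ≤ length rest
      unique : Unique (first ∷ rest)
      closed : Linked _~_ (first ∷ rest ∷ʳ first)

  record IsTree : Set where
    field
      connected : Connected
      acyclic   : ¬ Cycle

  record IsOddTree : Set where
    field
      isTree : IsTree
      odd    : ∀ u → degree u % 2 ≡ 1
    open IsTree isTree public

  walk? : ∀ k u v → Dec (Walk k u v)
  walk? 0 u v = map′ (λ { refl → [] }) (λ { [] → refl }) (u Fin.≟ v)
  walk? (ℕ.suc k) u w =
    map′ (λ { (_ , e , p) → e ∷ p }) (λ { (e ∷ p) → _ , e , p })
         (any? λ v → (u ~? v) ×-dec walk? k v w)

record ConnectedGraph : Set₁ where
  constructor mkConnected
  field
    {order}   : ℕ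
    graph     : Graph order
    connected : Connected graph

------------------------------------------------------------------------
-- Distances

least : ∀ {P : Pred ℕ 0ℓ} → Decidable P → ∀ k → P k →
        ∃ λ m → P m × (∀ j → P j → m ≤ j)
least P? k pk with P? 0
... | yes p0 = 0 , p0 , λ _ _ → z≤n
least P? 0         pk | no ¬p0 = contradiction pk ¬p0
least P? (ℕ.suc k) pk | no ¬p0 with least (P? ∘ ℕ.suc) k pk
... | m , pm , min =
  ℕ.suc m , pm , λ { 0 p0 → contradiction p0 ¬p0 ; (ℕ.suc j) pj → s≤s (min j pj) }

module _ (G : ConnectedGraph) where
  open ConnectedGraph G

  -- The length of a shortest walk; a shortest walk is always a path.

  shortest : ∀ u v → ∃ λ d → Walk graph d u v × (∀ k → Walk graph k u v → d ≤ k)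
  shortest u v = least (λ k → walk? graph k u v) (proj₁ (connected u v)) (proj₂ (connected u v))

  dist : Fin order → Fin order → ℕ
  dist u v = proj₁ (shortest u v)

  dist-nonZero : ∀ {u v} → u ≢ v → NonZero (dist u v)
  dist-nonZero {u} {v} u≢v with shortest u v
  ... | 0       , [] , _ = contradiction refl u≢v
  ... | ℕ.suc _ , _  , _ = _

  dist⁺ : ∀ {u v} → u ≢ v → ℕ⁺
  dist⁺ {u} {v} u≢v = dist u v , [ dist-nonZero u≢v ]

-- Each unordered pair {u , v} of distinct vertices is listed once, with u < v.

unorderedPairs : ∀ n → List (∃₂ λ (u v : Fin n) → u ≢ v)
unorderedPairs n = concatMap (λ v → tabulate (λ u → inject {i = v} u , v , inject≢ v u)) (allFin n)
  where
  inject≢ : (v : Fin n) (u : Fin (toℕ v)) → inject {i = v} u ≢ v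
  inject≢ v u eq =
    ℕ.<⇒≢ (toℕ<n u) (trans (sym (toℕ-inject {i = v} u)) (cong toℕ eq))

distanceSequence : ConnectedGraph → List ℕ⁺
distanceSequence G =
  Sort.sort ℕ⁺-decTotalOrder
    (map (λ (_ , _ , u≢v) → dist⁺ G u≢v) (unorderedPairs (ConnectedGraph.order G)))

------------------------------------------------------------------------
-- Distance-based topological indices

TopologicalIndex : Set₁
TopologicalIndex = ConnectedGraph → ℝ

Nondecreasing Nonincreasing : (List ℕ⁺ → ℝ) → Set
Nondecreasing g = ∀ xs {a b} ys → value a ≤ value b → g (xs ++ a ∷ ys) ≤ᴿ g (xs ++ b ∷ ys)
Nonincreasing g = ∀ xs {a b} ys → value a ≤ value b → g (xs ++ b ∷ ys) ≤ᴿ g (xs ++ a ∷ ys)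

_IsExpressedBy_ : TopologicalIndex → (List ℕ⁺ → ℝ) → Set₁
I IsExpressedBy g = ∀ G → I G ≃ g (distanceSequence G)

NondecreasingDistanceBased NonincreasingDistanceBased : TopologicalIndex → Set₁
NondecreasingDistanceBased I = ∃ λ g → I IsExpressedBy g × Nondecreasing g
NonincreasingDistanceBased I = ∃ λ g → I IsExpressedBy g × Nonincreasing g

------------------------------------------------------------------------
-- The extremal tree

-- The vertices 0, …, m form the path, and m + i is the leaf attached to
-- the internal vertex i.

module Caterpillar (m : ℕ) where

  PathEdge LeafEdge Edge : Rel ℕ 0ℓ
  PathEdge i j = j ≡ ℕ.suc i × j ≤ m
  LeafEdge i j = (0 < i × i < m) × j ≡ m + i
  Edge i j = PathEdge i j ⊎ LeafEdge i j

  edge? : B.Decidable Edge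
  edge? i j = ((j ℕ.≟ ℕ.suc i) ×-dec (j ℕ.≤? m)) ⊎-dec
              (((0 ℕ.<? i) ×-dec (i ℕ.<? m)) ×-dec (j ℕ.≟ m + i))

  edge⇒< : ∀ {i j} → Edge i j → i < j
  edge⇒< (inj₁ (refl , _)) = ℕ.n<1+n _
  edge⇒< {i} (inj₂ ((0<i , i<m) , refl)) = ℕ.<-≤-trans i<m (ℕ.m≤m+n m i)

  graph : Graph (2 * m)
  graph = record
    { _~_    = λ u v → Edge (toℕ u) (toℕ v) ⊎ Edge (toℕ v) (toℕ u)
    ; _~?_   = λ u v → edge? (toℕ u) (toℕ v) ⊎-dec edge? (toℕ v) (toℕ u)
    ; ~-sym  = swap
    ; irrefl = λ { (inj₁ e) → ℕ.<-irrefl refl (edge⇒< e)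
                 ; (inj₂ e) → ℕ.<-irrefl refl (edge⇒< e) }
    }

  open Graph graph

  parent : ∀ j → 0 < j → j < 2 * m → ∃ λ i → Edge i j
  parent (ℕ.suc i) _ j<2m with ℕ.suc i ℕ.≤? m
  ... | yes j≤m = i , inj₁ (refl , j≤m)
  ... | no  j≰m = ℕ.suc i ∸ m , inj₂ ((ℕ.m<n⇒0<n∸m m<j , lt) , sym eq)
    where
    m<j : m < ℕ.suc i
    m<j = ℕ.≰⇒> j≰m
    eq : m + (ℕ.suc i ∸ m) ≡ ℕ.suc i
    eq = ℕ.m+[n∸m]≡n (ℕ.<⇒≤ m<j)
    lt : ℕ.suc i ∸ m < m
    lt = ℕ.+-cancelˡ-< m _ _
      (subst (_< m + m) (sym eq) (subst (λ z → ℕ.suc i < m + z) (ℕ.+-identityʳ m) j<2m))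

  _++ʷ_ : ∀ {k l u v w} → Walk graph k u v → Walk graph l v w → Walk graph (k + l) u w
  []      ++ʷ q = q
  (e ∷ p) ++ʷ q = e ∷ (p ++ʷ q)

  reverse : ∀ {k u v} → Walk graph k u v → ∃ λ l → Walk graph l v u
  reverse []          = 0 , []
  reverse (_∷_ {u = u} {v} e p) = _ , proj₂ (reverse p) ++ʷ (~-sym {u} {v} e ∷ [])

  toRoot : ∀ b (u r : Fin (2 * m)) → toℕ r ≡ 0 → toℕ u ≤ b → ∃ λ k → Walk graph k u r
  toRoot b u r r≡0 u≤b with toℕ u ℕ.≟ 0
  ... | yes u≡0 = 0 , subst (Walk graph 0 u) (toℕ-injective (trans u≡0 (sym r≡0))) []
  toRoot 0 u r r≡0 u≤0 | no u≢0 = contradiction (ℕ.n≤0⇒n≡0 u≤0) u≢0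
  toRoot (ℕ.suc b) u r r≡0 u≤b | no u≢0 with parent (toℕ u) (ℕ.n≢0⇒n>0 u≢0) (toℕ<n u)
  ... | i , e = _ , inj₂ (subst (λ z → Edge z (toℕ u)) (sym p≡i) e) ∷ proj₂ rec
    where
    i<u : i < toℕ u
    i<u = edge⇒< e
    i<2m : i < 2 * m
    i<2m = ℕ.<-trans i<u (toℕ<n u)
    p≡i : toℕ (fromℕ< i<2m) ≡ i
    p≡i = toℕ-fromℕ< i<2m
    rec = toRoot b (fromℕ< i<2m) r r≡0
            (subst (_≤ b) (sym p≡i) (ℕ.s≤s⁻¹ (ℕ.≤-trans i<u u≤b)))

  connected : Connected graph
  connected u v = _ , proj₂ (rooted u) ++ʷ proj₂ (reverse (proj₂ (rooted v)))
    where
    0<2m : 0 < 2 * m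
    0<2m = ℕ.≤-<-trans z≤n (toℕ<n u)
    rooted : ∀ w → ∃ λ k → Walk graph k w (fromℕ< 0<2m)
    rooted w = toRoot _ w _ (toℕ-fromℕ< 0<2m) ℕ.≤-refl

-- Only meaningful for even n ≥ 4, when the order 2 * (n / 2) is n.
-- For n = 4 the path 0 – 1 – 2 with the leaf 3 attached to 1 is the star S₄.

T[_] : ℕ → ConnectedGraph
T[ n ] = mkConnected (Caterpillar.graph (n / 2)) (Caterpillar.connected (n / 2))

{-# OPTIONS --safe #-}

-- An odd tree grows from a single edge by repeatedly attaching two new vertices x, y to an old
-- vertex u: as long as every vertex of the part built so far has odd degree in it, a vertex with a
-- neighbour outside has at least two of them, and by acyclicity both have no other neighbour inside.
-- If the part has 2p vertices, then the ball of radius j around any of its vertices has at least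
-- min(2p, 2j) vertices in the part, and so x and y are close to many old vertices. Hence the number
-- of pairs at distance at most r is at least a quantity depending only on r and the order. Growing
-- the caterpillar from one end of its path attains this bound at each step. Finally, sorting turns
-- the inequalities between these counts into a coordinatewise comparison of distance sequences.

module Submission where

open import Defs
open import Level using (0ℓ)
open import Data.Fin.Base using (Fin; toℕ; zero; suc; inject; fromℕ<)
import Data.Fin.Properties as Fin
open import Data.List.Base using (List; []; _∷_; [_]; _++_; _∷ʳ_; length; map; filter; concatMap; tabulate; allFin; upTo; applyUpTo; downFrom; applyDownFrom)
open import Data.List.Properties using (map-∘; map-cong; map-tabulate; map-++; length-map; ++-assoc; ++-identityʳ; length-tabulate; reverse-downFrom; filter-accept; filter-reject; filter-none; filter-++; length-++)
open import Data.List.Membership.Propositional using (_∈_; find)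
open import Data.List.Membership.Propositional.Properties using (∈-∃++; ∈-++⁻; ∈-allFin)
open import Data.List.Relation.Unary.Any as Any using (Any; here; there)
open import Data.List.Relation.Unary.All as All using (All; []; _∷_)
import Data.List.Relation.Unary.All.Properties as All
open import Data.List.Relation.Unary.AllPairs as AllPairs using (AllPairs; []; _∷_)
import Data.List.Relation.Unary.AllPairs.Properties as AllPairs
open import Data.List.Relation.Unary.Linked using (Linked; [-]; _∷_)
open import Data.List.Relation.Unary.Unique.Propositional using (Unique)
open import Data.List.Relation.Unary.Unique.Propositional.Properties using (allFin⁺)
open import Data.List.Relation.Unary.Sorted.TotalOrder.Properties using (Sorted⇒AllPairs)
open import Data.List.Relation.Binary.Pointwise using (Pointwise; []; _∷_)
open import Data.List.Relation.Binary.Permutation.Propositional as Perm using (_↭_; prep; swap; ↭-refl; ↭-reflexive; ↭-sym; ↭-trans; ↭⇒↭ₛ)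
open import Data.List.Relation.Binary.Permutation.Propositional.Properties using (map⁺; ↭-length; shift; shifts; ++⁺ˡ; ++-comm; ↭-reverse; ∈-resp-↭; filter-↭)
import Data.List.Relation.Binary.Permutation.Setoid.Properties as Permₛ
import Data.List.Sort as Sort
open import Data.Nat.Base
open import Data.Nat.DivMod using (m*n/n≡m)
open import Data.Nat.ListAction using (sum)
open import Data.Nat.ListAction.Properties using (sum-++; sum-↭)
open import Data.Nat.Properties
open import Algebra.Properties.CommutativeSemigroup +-commutativeSemigroup using (interchange; x∙yz≈y∙xz)
open import Data.Product.Base using (_×_; _,_; proj₁; proj₂; ∃; ∃₂)
open import Data.Refinement using (value)
open import Data.Sum.Base using (_⊎_; inj₁; inj₂)
open import Function.Base using (id; _∘_)
open import Relation.Binary.Bundles using (DecTotalOrder)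
open import Relation.Binary.PropositionalEquality hiding ([_])
open import Relation.Nullary using (¬_; yes; no; contradiction)
open import Relation.Unary using (Pred; Decidable)

private variable
  A B : Set

-- Sums over lists, and counting by sums of indicators.

∑ : (A → ℕ) → List A → ℕ
∑ f xs = sum (map f xs)

∑-↭ : ∀ (f : A → ℕ) {xs ys} → xs ↭ ys → ∑ f xs ≡ ∑ f ys
∑-↭ f p = sum-↭ (map⁺ f p)

∑-mono : ∀ {f g : A → ℕ} {xs} → All (λ x → f x ≤ g x) xs → ∑ f xs ≤ ∑ g xs
∑-mono []       = z≤n
∑-mono (p ∷ ps) = +-mono-≤ p (∑-mono ps)

∑-concatMap : ∀ (f : B → ℕ) (h : A → List B) xs → ∑ f (concatMap h xs) ≡ ∑ (λ x → ∑ f (h x)) xs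
∑-concatMap f h []       = refl
∑-concatMap f h (x ∷ xs) = begin
  ∑ f (h x ++ concatMap h xs)                 ≡⟨ cong sum (map-++ f (h x) _) ⟩
  sum (map f (h x) ++ map f (concatMap h xs)) ≡⟨ sum-++ (map f (h x)) _ ⟩
  ∑ f (h x) + ∑ f (concatMap h xs)            ≡⟨ cong (∑ f (h x) +_) (∑-concatMap f h xs) ⟩
  ∑ f (h x) + ∑ (λ x → ∑ f (h x)) xs          ∎
  where open ≡-Reasoning

∑-+ : ∀ (f g : A → ℕ) xs → ∑ (λ x → f x + g x) xs ≡ ∑ f xs + ∑ g xs
∑-+ f g []       = refl
∑-+ f g (x ∷ xs) rewrite ∑-+ f g xs = interchange (f x) (g x) _ _

-- within r d is 1 if d < r and 0 otherwise.
within : ℕ → ℕ → ℕ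
within zero    _       = 0
within (suc r) zero    = 1
within (suc r) (suc d) = within r d

within-≤1 : ∀ r d → within r d ≤ 1
within-≤1 zero    _       = z≤n
within-≤1 (suc r) zero    = ≤-refl
within-≤1 (suc r) (suc d) = within-≤1 r d

within-< : ∀ {r d} → d < r → within r d ≡ 1
within-< {suc r} {zero}  _         = refl
within-< {suc r} {suc d} (s≤s d<r) = within-< d<r

within-≥ : ∀ {r d} → r ≤ d → within r d ≡ 0
within-≥ {zero}          _         = refl
within-≥ {suc r} {suc d} (s≤s r≤d) = within-≥ r≤d

within-antimono : ∀ r {d e} → d ≤ e → within r e ≤ within r d
within-antimono zero    _         = z≤n
within-antimono (suc r) {zero} {e} _ = within-≤1 (suc r) e
within-antimono (suc r) (s≤s d≤e) = within-antimono r d≤e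

∑-within-≤ : ∀ r (f : A → ℕ) xs → ∑ (within r ∘ f) xs ≤ length xs
∑-within-≤ r f []       = z≤n
∑-within-≤ r f (x ∷ xs) = +-mono-≤ (within-≤1 r (f x)) (∑-within-≤ r f xs)

∑-within-< : ∀ {r} {f : A → ℕ} {xs} → All (λ x → f x < r) xs → ∑ (within r ∘ f) xs ≡ length xs
∑-within-< []       = refl
∑-within-< (p ∷ ps) = cong₂ _+_ (within-< p) (∑-within-< ps)

∑-within-≥ : ∀ {r} {f : A → ℕ} {xs} → All (λ x → r ≤ f x) xs → ∑ (within r ∘ f) xs ≡ 0
∑-within-≥ []       = refl
∑-within-≥ (p ∷ ps) = cong₂ _+_ (within-≥ p) (∑-within-≥ ps)

∑-within-pos : ∀ {r y} {f : A → ℕ} {xs} → All (λ x → y ≤ f x) xs → 0 < ∑ (within r ∘ f) xs → y < r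
∑-within-pos {r = r} {y} {f} ps pos with y <? r
... | yes y<r = y<r
... | no  y≮r = contradiction (∑-within-≥ (All.map (≤-trans (≮⇒≥ y≮r)) ps)) (>⇒≢ pos)

-- Sums over unordered pairs of list entries.

pairs : (A → A → ℕ) → List A → ℕ
pairs f []       = 0
pairs f (x ∷ xs) = ∑ (f x) xs + pairs f xs

pairs-↭ : ∀ {f : A → A → ℕ} → (∀ x y → f x y ≡ f y x) → ∀ {xs ys} → xs ↭ ys → pairs f xs ≡ pairs f ys
pairs-↭ f-sym Perm.refl = refl
pairs-↭ {f = f} f-sym (prep x p) = cong₂ _+_ (∑-↭ (f x) p) (pairs-↭ f-sym p)
pairs-↭ {f = f} f-sym {_} {_ ∷ _ ∷ ys} (swap x y p)
  rewrite ∑-↭ (f x) p | ∑-↭ (f y) p | pairs-↭ f-sym p | f-sym x y =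
  interchange (f y x) (∑ (f x) ys) (∑ (f y) ys) (pairs f ys)
pairs-↭ f-sym (Perm.trans p q) = trans (pairs-↭ f-sym p) (pairs-↭ f-sym q)

pairs-map : ∀ (f : B → B → ℕ) (h : A → B) xs → pairs f (map h xs) ≡ pairs (λ x y → f (h x) (h y)) xs
pairs-map f h []       = refl
pairs-map f h (x ∷ xs) = cong₂ _+_ (cong sum (sym (map-∘ xs))) (pairs-map f h xs)

pairs-mono : ∀ {f g : A → A → ℕ} {xs} → AllPairs (λ x y → f x y ≤ g x y) xs → pairs f xs ≤ pairs g xs
pairs-mono []       = z≤n
pairs-mono (p ∷ ps) = +-mono-≤ (∑-mono p) (pairs-mono ps)

-- `unorderedPairs` groups the pairs by their larger vertex, `pairs` by the smaller one. In the
-- induction the column of `zero` is empty, and every later column starts with its pair with `zero`;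
-- these first entries make up the first summand of `pairs`.
∑-unorderedPairs : ∀ n (f : Fin n → Fin n → ℕ) →
  ∑ (λ (u , v , _) → f u v) (unorderedPairs n) ≡ pairs f (allFin n)
∑-unorderedPairs n f = begin
  ∑ (λ (u , v , _) → f u v) (unorderedPairs n)
    ≡⟨ ∑-concatMap _ _ (allFin n) ⟩
  _ ≡⟨ cong sum (map-cong (λ v → cong sum (map-tabulate {n = toℕ v} _ _)) (allFin n)) ⟩
  ∑ (λ v → sum (tabulate λ u → f (inject {i = v} u) v)) (allFin n)
    ≡⟨ below n f ⟩
  pairs f (allFin n) ∎
  where
  open ≡-Reasoning
  below : ∀ n (f : Fin n → Fin n → ℕ) →
    ∑ (λ v → sum (tabulate λ u → f (inject {i = v} u) v)) (allFin n) ≡ pairs f (allFin n)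
  below zero    f = refl
  below (suc n) f = begin
    ∑ column (tabulate suc)          ≡⟨ cong (∑ column) (map-tabulate id suc) ⟨
    ∑ column (map suc (allFin n))    ≡⟨ cong sum (map-∘ (allFin n)) ⟨
    ∑ (column ∘ suc) (allFin n)      ≡⟨ ∑-+ (f zero ∘ suc) _ (allFin n) ⟩
    ∑ (f zero ∘ suc) (allFin n) +
      ∑ (λ v → sum (tabulate λ u → f (suc (inject {i = v} u)) (suc v))) (allFin n)
      ≡⟨ cong₂ _+_ (cong sum (map-∘ (allFin n)))
           (trans (below n λ u v → f (suc u) (suc v)) (sym (pairs-map f suc (allFin n)))) ⟩
    pairs f (zero ∷ map suc (allFin n))
      ≡⟨ cong (λ xs → pairs f (zero ∷ xs)) (map-tabulate id suc) ⟩
    pairs f (allFin (suc n)) ∎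
    where
    column : Fin (suc n) → ℕ
    column v = sum (tabulate λ u → f (inject {i = v} u) v)

map-toℕ-allFin : ∀ n → map toℕ (allFin n) ≡ upTo n
map-toℕ-allFin n = trans (map-tabulate id toℕ) (tabulate-toℕ n id)
  where
  tabulate-toℕ : ∀ n (f : ℕ → A) → tabulate (f ∘ toℕ {n}) ≡ applyUpTo f n
  tabulate-toℕ zero    f = refl
  tabulate-toℕ (suc n) f = cong (f 0 ∷_) (tabulate-toℕ n (f ∘ suc))

-- Coordinatewise comparison of distance sequences.

_≤⁺_ : ℕ⁺ → ℕ⁺ → Set
a ≤⁺ b = value a ≤ value b

_≼_ : List ℕ⁺ → List ℕ⁺ → Set
_≼_ = Pointwise _≤⁺_

-- The count hypothesis for `r = value y` yields an entry of the first list that is at most the head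
-- `y`, and the head `x` is at most that entry. For the tails: if `y` is counted, removing the heads
-- lowers the count on the right by exactly one and that on the left by at most one; if `y` is not
-- counted, nothing in the sorted tail `ys` is counted either.
sorted-≼ : ∀ {xs ys} → AllPairs _≤⁺_ xs → AllPairs _≤⁺_ ys → length xs ≡ length ys →
  (∀ r → ∑ (within (suc r) ∘ value) ys ≤ ∑ (within (suc r) ∘ value) xs) → xs ≼ ys
sorted-≼ {[]}     {[]}     _          _          _  _     = []
sorted-≼ {x ∷ xs} {y ∷ ys} (x≤ ∷ xs↗) (y≤ ∷ ys↗) eq count =
  s≤s⁻¹ (∑-within-pos {r = suc (value y)} {value x} {value} {x ∷ xs} (≤-refl ∷ x≤)
    (≤-trans y-counted (count (value y))))
  ∷ sorted-≼ xs↗ ys↗ (cong pred eq) tails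
  where
  y-counted : 0 < ∑ (within (suc (value y)) ∘ value) (y ∷ ys)
  y-counted rewrite within-< (n<1+n (value y)) = z<s
  tails : ∀ r → ∑ (within (suc r) ∘ value) ys ≤ ∑ (within (suc r) ∘ value) xs
  tails r with value y <? suc r
  ... | yes y<r = +-cancelˡ-≤ 1 _ _ (begin
    1 + ∑ (within (suc r) ∘ value) ys    ≡⟨ cong (_+ ∑ (within (suc r) ∘ value) ys) (within-< y<r) ⟨
    ∑ (within (suc r) ∘ value) (y ∷ ys)  ≤⟨ count r ⟩
    ∑ (within (suc r) ∘ value) (x ∷ xs)  ≤⟨ +-monoˡ-≤ _ (within-≤1 (suc r) (value x)) ⟩
    1 + ∑ (within (suc r) ∘ value) xs    ∎)
    where open ≤-Reasoning
  ... | no  y≮r = ≤-trans (≤-reflexive (∑-within-≥ (All.map (≤-trans (≮⇒≥ y≮r)) y≤))) z≤n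

pairsWithin : ℕ → ConnectedGraph → ℕ
pairsWithin r G = pairs (λ u v → within (suc r) (dist G u v)) (allFin (ConnectedGraph.order G))

module _ (G : ConnectedGraph) where
  open ConnectedGraph G

  private
    distances : List ℕ⁺
    distances = map (λ (_ , _ , u≢v) → dist⁺ G u≢v) (unorderedPairs order)

    sort-↭ : distanceSequence G ↭ distances
    sort-↭ = Sort.sort-↭ ℕ⁺-decTotalOrder distances

  distanceSequence-sorted : AllPairs _≤⁺_ (distanceSequence G)
  distanceSequence-sorted =
    Sorted⇒AllPairs (DecTotalOrder.totalOrder ℕ⁺-decTotalOrder) (Sort.sort-↗ ℕ⁺-decTotalOrder distances)

  length-distanceSequence : length (distanceSequence G) ≡ length (unorderedPairs order)
  length-distanceSequence = trans (↭-length sort-↭) (length-map _ (unorderedPairs order))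

  ∑-distanceSequence : ∀ r → ∑ (within (suc r) ∘ value) (distanceSequence G) ≡ pairsWithin r G
  ∑-distanceSequence r = begin
    ∑ (within (suc r) ∘ value) (distanceSequence G) ≡⟨ ∑-↭ (within (suc r) ∘ value) sort-↭ ⟩
    ∑ (within (suc r) ∘ value) distances            ≡⟨ cong sum (map-∘ (unorderedPairs order)) ⟨
    ∑ (λ (u , v , _) → within (suc r) (dist G u v)) (unorderedPairs order)
      ≡⟨ ∑-unorderedPairs order (λ u v → within (suc r) (dist G u v)) ⟩
    pairsWithin r G                                 ∎
    where open ≡-Reasoning

distanceSequence-≼ : ∀ {G H} → ConnectedGraph.order G ≡ ConnectedGraph.order H →
  (∀ r → pairsWithin r H ≤ pairsWithin r G) → distanceSequence G ≼ distanceSequence H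
distanceSequence-≼ {G} {H} eq count = sorted-≼ (distanceSequence-sorted G) (distanceSequence-sorted H)
  (trans (length-distanceSequence G)
    (trans (cong (length ∘ unorderedPairs) eq) (sym (length-distanceSequence H))))
  (λ r → subst₂ _≤_ (sym (∑-distanceSequence H r)) (sym (∑-distanceSequence G r)) (count r))

-- Coordinates are exchanged one at a time from the left; in `after`, `zs` is the prefix that has
-- been exchanged already.
nondecreasing-≼ : ∀ g → Nondecreasing g → ∀ {xs ys} → xs ≼ ys → g xs ≤ᴿ g ys
nondecreasing-≼ g mono = after []
  where
  after : ∀ zs {xs ys} → xs ≼ ys → g (zs ++ xs) ≤ᴿ g (zs ++ ys)
  after zs []       = λ _ l → l
  after zs {x ∷ xs} {y ∷ ys} (p ∷ ps) q l =
    subst₂ (λ as bs → g as ≤ᴿ g bs) (++-assoc zs (y ∷ []) xs) (++-assoc zs (y ∷ []) ys)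
      (after (zs ∷ʳ y) ps) q (mono zs xs p q l)

nonincreasing-≼ : ∀ g → Nonincreasing g → ∀ {xs ys} → xs ≼ ys → g ys ≤ᴿ g xs
nonincreasing-≼ g mono = after []
  where
  after : ∀ zs {xs ys} → xs ≼ ys → g (zs ++ ys) ≤ᴿ g (zs ++ xs)
  after zs []       = λ _ l → l
  after zs {x ∷ xs} {y ∷ ys} (p ∷ ps) q l =
    mono zs xs p q (subst₂ (λ as bs → g bs ≤ᴿ g as) (++-assoc zs (y ∷ []) xs) (++-assoc zs (y ∷ []) ys)
      (after (zs ∷ʳ y) ps) q l)

-- Growth by forks and the extremal numbers.

-- The minimal number of vertices at distance less than r, as long as the graph is not exhausted.
ball : ℕ → ℕ
ball 0             = 0
ball 1             = 1
ball (suc (suc r)) = 2 * suc r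

-- A grown list of length 2 * suc p has at least bound r p pairs at distance at most r, with
-- equality in the caterpillar.
bound : ℕ → ℕ → ℕ
bound r zero    = within r 0
bound r (suc p) = (within (suc r) 2 + c) + (c + bound r p)
  where c = 2 * suc p ⊓ ball r

-- The index is the number of forks. New vertices stand in front, so that `pairs` of the longer list
-- splits into contributions of `x`, of `y` and of the old list, in the same way as `bound`.
data Grown {n} (G : Graph n) : ℕ → List (Fin n) → Set where
  edge : ∀ {a b} → Graph._~_ G a b → Grown G 0 (a ∷ b ∷ [])
  fork : ∀ {p L u x y} → Grown G p L → u ∈ L → Graph._~_ G u x → Graph._~_ G u y →
         Grown G (suc p) (x ∷ y ∷ L)

length-grown : ∀ {n} {G : Graph n} {p L} → Grown G p L → length L ≡ 2 * suc p
length-grown (edge _)                = refl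
length-grown (fork {p = p} g _ _ _) = trans (cong (2 +_) (length-grown g)) (sym (*-suc 2 (suc p)))

-- The metric of a connected graph.

module _ (G : ConnectedGraph) where
  open ConnectedGraph G
  open Graph graph

  dist-≤ : ∀ {k u v} → Walk graph k u v → dist G u v ≤ k
  dist-≤ {k} {u} {v} = proj₂ (proj₂ (shortest G u v)) k

  dist-walk : ∀ u v → Walk graph (dist G u v) u v
  dist-walk u v = proj₁ (proj₂ (shortest G u v))

  dist-refl : ∀ u → dist G u u ≡ 0
  dist-refl u = n≤0⇒n≡0 (dist-≤ {u = u} [])

  dist-step : ∀ {u v} → u ~ v → ∀ w → dist G u w ≤ suc (dist G v w)
  dist-step {u} {v} e w = dist-≤ (e ∷ dist-walk v w)

  reverseOnto : ∀ {k l u v w} → Walk graph k u v → Walk graph l u w → Walk graph (k + l) v w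
  reverseOnto [] q = q
  reverseOnto {suc k} {l} {v = v} {w} (e ∷ p) q =
    subst (λ i → Walk graph i v w) (+-suc k l) (reverseOnto p (~-sym e ∷ q))

  dist-sym-≤ : ∀ u v → dist G v u ≤ dist G u v
  dist-sym-≤ u v = dist-≤ (subst (λ i → Walk graph i v u) (+-identityʳ _) (reverseOnto (dist-walk u v) []))

  dist-sym : ∀ u v → dist G u v ≡ dist G v u
  dist-sym u v = ≤-antisym (dist-sym-≤ v u) (dist-sym-≤ u v)

-- Balls and close pairs in a grown list.

module _ {n : ℕ} (G : Graph n) (d : Fin n → Fin n → ℕ)
  (d-refl : ∀ u → d u u ≡ 0) (d-sym : ∀ u v → d u v ≡ d v u)
  (d-step : ∀ {u v} → Graph._~_ G u v → ∀ w → d u w ≤ suc (d v w)) where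

  open Graph G

  private
    d-stepʳ : ∀ {u v} → u ~ v → ∀ w → d w u ≤ suc (d w v)
    d-stepʳ {u} {v} e w = subst₂ (λ a b → a ≤ suc b) (d-sym u w) (d-sym v w) (d-step e w)

    d-edge : ∀ {u v} → u ~ v → d u v ≤ 1
    d-edge {v = v} e = subst (λ a → d _ v ≤ suc a) (d-refl v) (d-step e v)

    d-siblings : ∀ {u x y} → u ~ x → u ~ y → d x y ≤ 2
    d-siblings e f = ≤-trans (d-step (~-sym e) _) (s≤s (d-edge f))

  -- A new vertex is at most one step farther than `u` from every old vertex, so a fork raises the
  -- diameter by at most one; the distance 2 between siblings fits as well.
  grown-diameter : ∀ {p L} → Grown G p L → ∀ {v w} → v ∈ L → w ∈ L → d v w ≤ suc p
  grown-diameter (edge e) (here refl) (here refl) = ≤-trans (≤-reflexive (d-refl _)) z≤n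
  grown-diameter (edge e) (here refl) (there (here refl)) = d-edge e
  grown-diameter (edge e) (there (here refl)) (here refl) = d-edge (~-sym e)
  grown-diameter (edge e) (there (here refl)) (there (here refl)) = ≤-trans (≤-reflexive (d-refl _)) z≤n
  grown-diameter {suc p} (fork {L = L} {u} {x} {y} g u∈L e f) = cases
    where
    old : ∀ {v w} → v ∈ L → w ∈ L → d v w ≤ suc p
    old = grown-diameter g
    self : ∀ v → d v v ≤ suc (suc p)
    self v = ≤-trans (≤-reflexive (d-refl v)) z≤n
    cases : ∀ {v w} → v ∈ x ∷ y ∷ L → w ∈ x ∷ y ∷ L → d v w ≤ suc (suc p)
    cases (here refl)         (here refl)         = self _
    cases (here refl)         (there (here refl)) = ≤-trans (d-siblings e f) (s≤s (s≤s z≤n))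
    cases (here refl)         (there (there w∈L)) = ≤-trans (d-step (~-sym e) _) (s≤s (old u∈L w∈L))
    cases (there (here refl)) (here refl)         = ≤-trans (d-siblings f e) (s≤s (s≤s z≤n))
    cases (there (here refl)) (there (here refl)) = self _
    cases (there (here refl)) (there (there w∈L)) = ≤-trans (d-step (~-sym f) _) (s≤s (old u∈L w∈L))
    cases (there (there v∈L)) (here refl)         = ≤-trans (d-stepʳ (~-sym e) _) (s≤s (old v∈L u∈L))
    cases (there (there v∈L)) (there (here refl)) = ≤-trans (d-stepʳ (~-sym f) _) (s≤s (old v∈L u∈L))
    cases (there (there v∈L)) (there (there w∈L)) = m≤n⇒m≤1+n (old v∈L w∈L)

  ∑-within-step : ∀ r {u v} → u ~ v → ∀ L → ∑ (within r ∘ d v) L ≤ ∑ (within (suc r) ∘ d u) L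
  ∑-within-step r e L = ∑-mono (All.universal (λ w → within-antimono (suc r) (d-step e w)) L)

  whole-grown : ∀ {p L v} → Grown G p L → v ∈ L → ∀ r → suc p < r → ∑ (within r ∘ d v) L ≡ 2 * suc p
  whole-grown g v∈L r p<r = trans
    (∑-within-< (All.tabulate λ w∈L → ≤-<-trans (grown-diameter g v∈L w∈L) p<r))
    (length-grown g)

  -- The ball around a new vertex `x` contains `x`, the sibling `y` once `r` exceeds 2, and, by way
  -- of `u`, the old vertices counted around `u` for `pred r`. For `r` at least 3 this matches the
  -- growth of `ball` by two.
  ball-fresh : ∀ {u x y L} r → u ~ x → u ~ y → ball (pred r) ≤ ∑ (within (pred r) ∘ d u) L →
    ball r ≤ within r (d x x) + (within r (d x y) + ∑ (within r ∘ d x) L)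
  ball-fresh 0 e f _ = z≤n
  ball-fresh {x = x} 1 e f _ rewrite d-refl x = s≤s z≤n
  -- Here `ball` grows only by one, which `x` itself supplies; the sibling may be at distance 2, so
  -- its term is dropped.
  ball-fresh {x = x} {y} {L} 2 e f IH rewrite d-refl x =
    s≤s (≤-trans (≤-trans IH (∑-within-step 1 (~-sym e) L)) (m≤n+m _ (within 2 (d x y))))
  ball-fresh {x = x} {y} {L} (suc (suc (suc r))) e f IH rewrite d-refl x = begin
    2 * suc (suc r)                              ≡⟨ *-suc 2 (suc r) ⟩
    1 + (within (3 + r) 2 + 2 * suc r)           ≤⟨ s≤s (+-mono-≤ (within-antimono (3 + r) (d-siblings e f))
                                                     (≤-trans IH (∑-within-step _ (~-sym e) L))) ⟩
    1 + (within (3 + r) (d x y) + ∑ (within (3 + r) ∘ d x) L) ∎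
    where open ≤-Reasoning

  self-within : ∀ {L v} r → v ∈ L → 0 < ∑ (within (suc r) ∘ d v) L
  self-within {v = v} r (here refl) rewrite d-refl v = z<s
  self-within {w ∷ _} {v} r (there v∈L) = ≤-trans (self-within r v∈L) (m≤n+m _ (within (suc r) (d v w)))

  -- For `r ≤ 2 + p` the value `ball r` does not exceed the size of the list. Around a new vertex,
  -- `ball-fresh` lowers the radius together with the number of forks; around an old vertex the old
  -- list already suffices, unless `r` is the largest value allowed.
  ball-grown-≤ : ∀ {p L v} → Grown G p L → v ∈ L → ∀ r → r ≤ 2 + p → ball r ≤ ∑ (within r ∘ d v) L
  ball-grown-≤ g        v∈L 0 _ = z≤n
  ball-grown-≤ g        v∈L 1 _ = self-within 0 v∈L
  ball-grown-≤ (edge e) v∈L (suc (suc (suc _))) (s≤s (s≤s ()))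
  ball-grown-≤ (edge e) v∈L 2 _ = ≤-reflexive (sym (whole-grown (edge e) v∈L 2 ≤-refl))
  ball-grown-≤ (fork {L = L} g u∈L e f) (here refl) r@(suc _) r≤ =
    ball-fresh {L = L} r e f (ball-grown-≤ g u∈L (pred r) (pred-mono-≤ r≤))
  ball-grown-≤ (fork {L = L} {x = x} {y} g u∈L e f) (there (here refl)) r@(suc _) r≤ = ≤-trans
    (ball-fresh {L = L} r f e (ball-grown-≤ g u∈L (pred r) (pred-mono-≤ r≤)))
    (≤-reflexive (x∙yz≈y∙xz (within r (d y y)) (within r (d y x)) (∑ (within r ∘ d y) L)))
  ball-grown-≤ {v = v} (fork {L = L} {x = x} {y} g u∈L e f) (there (there v∈L)) r@(suc (suc _)) r≤
    with m≤n⇒m<n∨m≡n r≤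
  ... | inj₁ r<   = ≤-trans (ball-grown-≤ g v∈L r (s≤s⁻¹ r<))
    (≤-trans (m≤n+m (∑ (within r ∘ d v) L) (within r (d v y))) (m≤n+m _ (within r (d v x))))
  -- At the largest `r`, `ball r` is the size of the whole list, and by the diameter bound every
  -- vertex of the list is counted.
  ... | inj₂ refl = ≤-reflexive (sym (whole-grown (fork g u∈L e f) (there (there v∈L)) r ≤-refl))

  ball-grown : ∀ {p L v} → Grown G p L → v ∈ L → ∀ r → 2 * suc p ⊓ ball r ≤ ∑ (within r ∘ d v) L
  ball-grown {p} g v∈L r with r ≤? suc p
  ... | yes r≤p = ≤-trans (m⊓n≤n (2 * suc p) _) (ball-grown-≤ g v∈L r (m≤n⇒m≤1+n r≤p))
  ... | no  r≰p = ≤-trans (m⊓n≤m _ (ball r)) (≤-reflexive (sym (whole-grown g v∈L r (≰⇒> r≰p))))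

  -- The summands of a fork match those of `bound`: the siblings have distance at most 2, and an old
  -- vertex at distance less than `r` from `u` has distance at most `r` from both `x` and `y`.
  bound-grown : ∀ {p L} → Grown G p L → ∀ r → bound r p ≤ pairs (λ u v → within (suc r) (d u v)) L
  bound-grown (edge e) r = ≤-trans (within-antimono (suc r) (d-edge e))
    (≤-trans (m≤m+n _ 0) (m≤m+n _ 0))
  bound-grown (fork {L = L} g u∈L e f) r = +-mono-≤
    (+-mono-≤ (within-antimono (suc r) (d-siblings e f)) (≤-trans ball-u (∑-within-step r (~-sym e) L)))
    (+-mono-≤ (≤-trans ball-u (∑-within-step r (~-sym f) L)) (bound-grown g r))
    where ball-u = ball-grown g u∈L r

pairs-grown : ∀ (G : ConnectedGraph) {p L} → Grown (ConnectedGraph.graph G) p L →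
  L ↭ allFin (ConnectedGraph.order G) → ∀ r → bound r p ≤ pairsWithin r G
pairs-grown G g L↭ r = ≤-trans
  (bound-grown (ConnectedGraph.graph G) (dist G) (dist-refl G) (dist-sym G) (dist-step G) g r)
  (≤-reflexive (pairs-↭ (λ u v → cong (within (suc r)) (dist-sym G u v)) L↭))

-- The caterpillar attains the extremal numbers.

-- The distances to truncation p (below) from a vertex attached to or beyond its end, up to a
-- common shift.
profile : ℕ → List ℕ
profile zero    = 0 ∷ 1 ∷ []
profile (suc p) = 0 ∷ 2 ∷ map suc (profile p)

length-profile : ∀ p → length (profile p) ≡ 2 * suc p
length-profile zero    = refl
length-profile (suc p) = trans (cong (2 +_) (trans (length-map suc (profile p)) (length-profile p)))
  (sym (*-suc 2 (suc p)))

∑-profile-suc : ∀ r p → ∑ (within (suc r)) (map suc (profile p)) ≡ ∑ (within r) (profile p)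
∑-profile-suc r p = cong sum (sym (map-∘ (profile p)))

-- In sorted order `profile p` is 0, 1, and then each of 2, ..., `suc p` twice. In the recursion the
-- shift by `suc` lowers `r` by one, and the fresh entries 0 and 2 account for the growth of `ball`.
∑-profile-≤-ball : ∀ r p → ∑ (within r) (profile p) ≤ ball r
∑-profile-≤-ball 0             p       = ≤-reflexive (∑-within-≥ {f = id} (All.universal (λ _ → z≤n) (profile p)))
∑-profile-≤-ball 1             zero    = ≤-refl
∑-profile-≤-ball (suc (suc r)) zero    = *-monoʳ-≤ 2 (s≤s z≤n)
∑-profile-≤-ball (suc r)       (suc p) rewrite ∑-profile-suc r p with r | ∑-profile-≤-ball r p
... | 0           | IH = s≤s IH
... | 1           | IH = s≤s IH
... | suc (suc r) | IH = ≤-trans (s≤s (s≤s IH)) (≤-reflexive (sym (*-suc 2 (suc r))))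

∑-profile-≤ : ∀ r p → ∑ (within r) (profile p) ≤ 2 * suc p ⊓ ball r
∑-profile-≤ r p = ⊓-glb
  (≤-trans (∑-within-≤ r id (profile p)) (≤-reflexive (length-profile p)))
  (∑-profile-≤-ball r p)

∣m+n-n∣≡m : ∀ a b → ∣ a + b - b ∣ ≡ a
∣m+n-n∣≡m a b = trans (cong ∣_- b ∣ (+-comm a b)) (trans (∣-∣-comm (b + a) b) (∣m-m+n∣≡n b a))

module _ (m : ℕ) where
  open Caterpillar m using (Edge)

  -- Coordinates that make distances explicit without any walks: a leaf lies at height 1 above the
  -- path vertex that carries it.
  position height : ℕ → ℕ
  position j with j ≤? m
  ... | yes _ = j
  ... | no  _ = j ∸ m
  height j with j ≤? m
  ... | yes _ = 0
  ... | no  _ = 1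

  position-path : ∀ {j} → j ≤ m → position j ≡ j
  position-path {j} j≤m with j ≤? m
  ... | yes _   = refl
  ... | no  j≰m = contradiction j≤m j≰m

  height-path : ∀ {j} → j ≤ m → height j ≡ 0
  height-path {j} j≤m with j ≤? m
  ... | yes _   = refl
  ... | no  j≰m = contradiction j≤m j≰m

  position-leaf : ∀ i → position (m + suc i) ≡ suc i
  position-leaf i with m + suc i ≤? m
  ... | yes le = contradiction le (m+1+n≰m m)
  ... | no  _  = m+n∸m≡n m (suc i)

  height-leaf : ∀ i → height (m + suc i) ≡ 1
  height-leaf i with m + suc i ≤? m
  ... | yes le = contradiction le (m+1+n≰m m)
  ... | no  _  = refl

  -- The distance in the caterpillar, except that a leaf gets span 2 to itself.
  span : ℕ → ℕ → ℕ
  span u v = ∣ position u - position v ∣ + (height u + height v)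

  span-sym : ∀ u v → span u v ≡ span v u
  span-sym u v = cong₂ _+_ (∣-∣-comm (position u) (position v)) (+-comm (height u) (height v))

  span-edge : ∀ {u v} → Edge u v → span u v ≤ 1
  span-edge {u} (inj₁ (refl , u<m))
    rewrite position-path u<m | height-path u<m | position-path (<⇒≤ u<m) | height-path (<⇒≤ u<m)
          | ∣-∣-comm u (suc u) | ∣m+n-n∣≡m 1 u = ≤-refl
  span-edge {suc i} (inj₂ ((_ , i<m) , refl))
    rewrite position-path (<⇒≤ i<m) | height-path (<⇒≤ i<m) | position-leaf i | height-leaf i | ∣n-n∣≡0 i = ≤-refl

  span-adjacent : ∀ {u v} → Edge u v ⊎ Edge v u → span u v ≤ 1
  span-adjacent         (inj₁ e) = span-edge e
  span-adjacent {u} {v} (inj₂ e) = subst (_≤ 1) (span-sym v u) (span-edge e)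

  span-triangle : ∀ u v w → span u w ≤ span u v + span v w
  span-triangle u v w = begin
    span u w ≤⟨ +-mono-≤ (∣-∣-triangle (position u) (position v) (position w))
                  (+-mono-≤ (m≤m+n (height u) (height v)) (m≤n+m (height w) (height v))) ⟩
    (∣ position u - position v ∣ + ∣ position v - position w ∣) +
      ((height u + height v) + (height v + height w))
             ≡⟨ interchange ∣ position u - position v ∣ ∣ position v - position w ∣ _ _ ⟩
    span u v + span v w ∎
    where open ≤-Reasoning

  -- By the triangle inequality a quantity that is at most 1 on edges is at most the length of any
  -- walk. The alternative `u ≡ v` is there because the empty walk at a leaf has length 0 while the
  -- span is 2.
  span-walk : ∀ {k u v} → Walk (Caterpillar.graph m) k u v → u ≡ v ⊎ span (toℕ u) (toℕ v) ≤ k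
  span-walk [] = inj₁ refl
  span-walk {suc k} {u} {w} (_∷_ {v = v} e p) with span-walk p
  ... | inj₁ refl = inj₂ (≤-trans (span-adjacent e) (s≤s z≤n))
  ... | inj₂ le = inj₂ (≤-trans (span-triangle (toℕ u) (toℕ v) (toℕ w)) (+-mono-≤ (span-adjacent e) le))

  -- The caterpillar cut off after the path vertex suc p.
  truncation : ℕ → List ℕ
  truncation zero    = 1 ∷ 0 ∷ []
  truncation (suc p) = suc (suc p) ∷ m + suc p ∷ truncation p

  truncation-↭ : ∀ p → truncation p ↭ downFrom (suc (suc p)) ++ applyDownFrom (λ i → m + suc i) p
  truncation-↭ zero    = ↭-refl
  truncation-↭ (suc p) = prep _ (↭-trans (prep _ (truncation-↭ p)) (↭-sym (shift _ (downFrom (suc (suc p))) _)))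

  span-offset : ∀ u v t {b c} → position v ≡ b → height v ≡ c → position u ≡ t + b →
    span u v ≡ t + height u + c
  span-offset u v t {b} refl refl eq = trans
    (cong (_+ (height u + height v)) (trans (cong ∣_- b ∣ eq) (∣m+n-n∣≡m t b)))
    (sym (+-assoc t (height u) (height v)))

  -- The vertex `v` lies `t` steps beyond the last path vertex `suc p`. Dropping that vertex and its
  -- successor in the list moves the end back by one, which raises `t` by one; this is the `map suc`
  -- in `profile`.
  span-truncation : ∀ p → suc p ≤ m → ∀ v t → position v ≡ t + suc p →
    map (span v) (truncation p) ≡ map (t + height v +_) (profile p)
  span-truncation zero p<m v t eq = cong₂ (λ a b → a ∷ b ∷ [])
    (span-offset v 1 t (position-path p<m) (height-path p<m) eq)
    (trans (span-offset v 0 (suc t) (position-path z≤n) (height-path z≤n) (trans eq (+-suc t 0)))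
      (sym (+-suc (t + height v) 0)))
  span-truncation (suc p) p<m v t eq = cong₂ _∷_
    (span-offset v (suc (suc p)) t (position-path p<m) (height-path p<m) eq)
    (cong₂ _∷_
      (trans (span-offset v (m + suc p) (suc t) (position-leaf p) (height-leaf p) eq+)
        (sym (+-suc (t + height v) 1)))
      (trans (span-truncation p (<⇒≤ p<m) v (suc t) eq+)
        (trans (map-cong (λ x → sym (+-suc (t + height v) x)) (profile p)) (map-∘ (profile p)))))
    where
    eq+ : position v ≡ suc t + suc p
    eq+ = trans eq (+-suc t (suc p))

  -- The condition `t + height v ≡ 1` covers both vertices of the next fork: the next path vertex
  -- (`t = 1`, height 0) and the leaf above the end (`t = 0`, height 1). Both therefore see the same
  -- profile shifted by one.
  ∑-truncation : ∀ r p → suc p ≤ m → ∀ {v t} → position v ≡ t + suc p → t + height v ≡ 1 →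
    ∑ (within (suc r) ∘ span v) (truncation p) ≤ 2 * suc p ⊓ ball r
  ∑-truncation r p p<m {v} {t} eq s≡1 = begin
    ∑ (within (suc r) ∘ span v) (truncation p)           ≡⟨ cong sum (map-∘ (truncation p)) ⟩
    ∑ (within (suc r)) (map (span v) (truncation p))
      ≡⟨ cong (∑ (within (suc r))) (span-truncation p p<m v t eq) ⟩
    ∑ (within (suc r)) (map (t + height v +_) (profile p))
      ≡⟨ cong (λ s → ∑ (within (suc r)) (map (s +_) (profile p))) s≡1 ⟩
    ∑ (within (suc r)) (map suc (profile p))             ≡⟨ ∑-profile-suc r p ⟩
    ∑ (within r) (profile p)                             ≤⟨ ∑-profile-≤ r p ⟩
    2 * suc p ⊓ ball r                                   ∎
    where open ≤-Reasoning

  pairs-truncation : ∀ r p → suc p ≤ m → pairs (λ u v → within (suc r) (span u v)) (truncation p) ≤ bound r p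
  pairs-truncation r zero p<m
    rewrite position-path p<m | height-path p<m | position-path {0} z≤n | height-path {0} z≤n
          | +-identityʳ (within r 0) | +-identityʳ (within r 0) = ≤-refl
  pairs-truncation r (suc p) p<m = +-mono-≤
    (+-mono-≤ (≤-reflexive (cong (within (suc r)) top))
      (∑-truncation r p (<⇒≤ p<m) {suc (suc p)} {1} (position-path p<m) (cong suc (height-path p<m))))
    (+-mono-≤ (∑-truncation r p (<⇒≤ p<m) {m + suc p} {0} (position-leaf p) (height-leaf p))
      (pairs-truncation r p (<⇒≤ p<m)))
    where
    top : span (suc (suc p)) (m + suc p) ≡ 2
    top rewrite position-path p<m | height-path p<m | position-leaf p | height-leaf p | ∣m+n-n∣≡m 1 p = refl

-- For `m = suc p` the path vertices are 0, ..., `m` and the leaves are `m + 1`, ..., `m + p`, so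
-- together they fill the range without a gap.
truncation-all : ∀ p → truncation (suc p) p ↭ upTo (2 * suc p)
truncation-all p = ↭-trans (truncation-↭ (suc p) p)
  (↭-trans (++-comm (downFrom (suc (suc p))) _)
  (↭-trans (↭-reflexive (trans (leaves p) (cong downFrom eq)))
  (↭-trans (↭-sym (↭-reverse _)) (↭-reflexive (reverse-downFrom (2 * suc p))))))
  where
  leaves : ∀ q → applyDownFrom (λ i → suc p + suc i) q ++ downFrom (suc (suc p)) ≡ downFrom (q + suc (suc p))
  leaves zero    = refl
  leaves (suc q) = cong₂ _∷_ (trans (cong suc (+-suc p q)) (trans (cong (2 +_) (+-comm p q))
    (sym (trans (+-suc q (suc p)) (cong suc (+-suc q p)))))) (leaves q)
  eq : p + suc (suc p) ≡ 2 * suc p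
  eq = trans (+-suc p (suc p)) (cong (λ q → suc p + suc q) (sym (+-identityʳ p)))

-- An upper bound on the number of close pairs needs distances bounded only from below, which `span`
-- provides for distinct vertices. The vertices are then reordered from numerical order to the order
-- of growth.
pairs-caterpillar : ∀ r p →
  pairsWithin r (mkConnected (Caterpillar.graph (suc p)) (Caterpillar.connected (suc p))) ≤
  bound r p
pairs-caterpillar r p = begin
  pairs (λ u v → within (suc r) (dist G u v)) (allFin (2 * suc p))
    ≤⟨ pairs-mono (AllPairs.map (λ {u} {v} u≢v → within-antimono (suc r) (span-≤-dist u v u≢v)) (allFin⁺ _)) ⟩
  pairs (λ u v → within (suc r) (span (suc p) (toℕ u) (toℕ v))) (allFin (2 * suc p))
    ≡⟨ pairs-map _ toℕ (allFin (2 * suc p)) ⟨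
  pairs (λ u v → within (suc r) (span (suc p) u v)) (map toℕ (allFin (2 * suc p)))
    ≡⟨ cong (pairs _) (map-toℕ-allFin (2 * suc p)) ⟩
  pairs (λ u v → within (suc r) (span (suc p) u v)) (upTo (2 * suc p))
    ≡⟨ pairs-↭ (λ u v → cong (within (suc r)) (span-sym (suc p) u v)) (truncation-all p) ⟨
  pairs (λ u v → within (suc r) (span (suc p) u v)) (truncation (suc p) p)
    ≤⟨ pairs-truncation (suc p) r p ≤-refl ⟩
  bound r p ∎
  where
  open ≤-Reasoning
  G = mkConnected (Caterpillar.graph (suc p)) (Caterpillar.connected (suc p))
  span-≤-dist : ∀ u v → u ≢ v → span (suc p) (toℕ u) (toℕ v) ≤ dist G u v
  span-≤-dist u v u≢v with span-walk (suc p) (dist-walk G u v)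
  ... | inj₁ u≡v = contradiction u≡v u≢v
  ... | inj₂ le  = le

-- Growing an odd tree by forks.

Unique-resp-↭ : ∀ {xs ys : List A} → xs ↭ ys → Unique xs → Unique ys
Unique-resp-↭ p = Permₛ.Unique-resp-↭ (setoid _) (↭⇒↭ₛ p)

Unique-++⁻ˡ : ∀ (xs : List A) {ys} → Unique (xs ++ ys) → Unique xs
Unique-++⁻ˡ []       _        = []
Unique-++⁻ˡ (x ∷ xs) (p ∷ ps) = All.++⁻ˡ xs p ∷ Unique-++⁻ˡ xs ps

∈⇒↭∷ : ∀ {x : A} {xs} → x ∈ xs → ∃ λ ys → xs ↭ x ∷ ys
∈⇒↭∷ x∈xs with ys , zs , refl ← ∈-∃++ x∈xs = ys ++ zs , shift _ ys zs

count-unique : ∀ {P : Pred A 0ℓ} (P? : Decidable P) {xs v} → Unique xs → v ∈ xs → P v →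
  (∀ {w} → w ∈ xs → P w → w ≡ v) → length (filter P? xs) ≡ 1
count-unique P? (v∉ ∷ _) (here refl) pv only = trans (cong length (filter-accept P? pv))
  (cong (suc ∘ length) (filter-none P? (All.tabulate λ w∈ pw → All.lookup v∉ w∈ (sym (only (there w∈) pw)))))
count-unique P? {x ∷ xs} (x∉ ∷ u) (there v∈) pv only = trans
  (cong length (filter-reject P? λ px → All.lookup x∉ v∈ (only (here refl) px)))
  (count-unique P? u v∈ pv (only ∘ there))

odd⇒suc-even : ∀ k → k % 2 ≡ 1 → suc k % 2 ≢ 1
odd⇒suc-even 1             _  ()
odd⇒suc-even (suc (suc k)) eq = odd⇒suc-even k eq

module _ {n : ℕ} (T : Graph n) (oddTree : IsOddTree T) where
  open Graph T
  open IsOddTree oddTree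

  ~⇒≢ : ∀ {u v} → u ~ v → u ≢ v
  ~⇒≢ e refl = irrefl e

  -- Unlike `Walk`, this carries the list of visited vertices, both ends included, from which a
  -- `Cycle` can be assembled.
  data Trail : Fin n → Fin n → List (Fin n) → Set where
    stop : ∀ {u} → Trail u u [ u ]
    _∷_  : ∀ {u v w P} → u ~ v → Trail v w P → Trail u w (u ∷ P)

  trail-∷ʳ : ∀ {u v w P} → Trail u v P → v ~ w → Trail u w (P ∷ʳ w)
  trail-∷ʳ stop    f = f ∷ stop
  trail-∷ʳ (e ∷ t) f = e ∷ trail-∷ʳ t f

  trail-linked : ∀ {u v w x P} → u ~ v → Trail v w P → w ~ x → Linked _~_ (u ∷ P ∷ʳ x)
  trail-linked e stop    f = e ∷ f ∷ [-]
  trail-linked e (g ∷ t) f = e ∷ trail-linked g t f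

  trail-long : ∀ {u v P} → u ≢ v → Trail u v P → 2 ≤ length P
  trail-long u≢v stop          = contradiction refl u≢v
  trail-long u≢v (e ∷ stop)    = s≤s (s≤s z≤n)
  trail-long u≢v (e ∷ (f ∷ t)) = s≤s (s≤s z≤n)

  -- Connectedness inside `L` in the form that acyclicity needs: a simple path staying in `L` can be
  -- closed through a vertex outside `L`.
  LinkedIn : List (Fin n) → Set
  LinkedIn L = ∀ {v w} → v ∈ L → w ∈ L → ∃ λ P → Trail v w P × Unique P × All (_∈ L) P

  linked-singleton : ∀ {u} → LinkedIn [ u ]
  linked-singleton (here refl) (here refl) = _ , stop , [] ∷ [] , here refl ∷ []

  linked-attach : ∀ {L u x} → LinkedIn L → All (x ≢_) L → u ∈ L → u ~ x → LinkedIn (x ∷ L)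
  linked-attach linked x∉L u∈L e (here refl) (here refl) = _ , stop , [] ∷ [] , here refl ∷ []
  linked-attach linked x∉L u∈L e (here refl) (there w∈L) with P , t , uP , P⊆L ← linked u∈L w∈L =
    _ , ~-sym e ∷ t , All.map (All.lookup x∉L) P⊆L ∷ uP , here refl ∷ All.map there P⊆L
  linked-attach linked x∉L u∈L e (there v∈L) (here refl) with P , t , uP , P⊆L ← linked v∈L u∈L =
    _ , trail-∷ʳ t e ,
    AllPairs.++⁺ uP ([] ∷ []) (All.map (λ z∈L → (λ z≡x → All.lookup x∉L z∈L (sym z≡x)) ∷ []) P⊆L) ,
    All.++⁺ (All.map there P⊆L) (here refl ∷ [])
  linked-attach linked x∉L u∈L e (there v∈L) (there w∈L) with P , t , uP , P⊆L ← linked v∈L w∈L =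
    P , t , uP , All.map there P⊆L

  -- Two different neighbours of `x` in `L`, joined by a path inside `L`, would give a cycle through
  -- `x`.
  entry-unique : ∀ {L v w x} → LinkedIn L → All (x ≢_) L → v ∈ L → w ∈ L → x ~ v → x ~ w → v ≡ w
  entry-unique {v = v} {w} linked x∉L v∈L w∈L e f with v Fin.≟ w
  ... | yes v≡w = v≡w
  ... | no  v≢w with P , t , uP , P⊆L ← linked v∈L w∈L = contradiction (record
    { long   = trail-long v≢w t
    ; unique = All.map (All.lookup x∉L) P⊆L ∷ uP
    ; closed = trail-linked e t (~-sym f)
    }) acyclic

  siblings-nonadjacent : ∀ {u x y} → u ~ x → u ~ y → ¬ (x ~ y)
  siblings-nonadjacent e f g = acyclic (record
    { long   = s≤s (s≤s z≤n)
    ; unique = (~⇒≢ e ∷ ~⇒≢ f ∷ []) ∷ (~⇒≢ g ∷ []) ∷ [] ∷ []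
    ; closed = e ∷ g ∷ ~-sym f ∷ [-]
    })

  neighbours : Fin n → List (Fin n) → ℕ
  neighbours v L = length (filter (v ~?_) L)

  neighbours-~ : ∀ {v x} L → v ~ x → neighbours v (x ∷ L) ≡ suc (neighbours v L)
  neighbours-~ {v} L e = cong length (filter-accept (v ~?_) e)

  neighbours-≁ : ∀ {v x} L → ¬ (v ~ x) → neighbours v (x ∷ L) ≡ neighbours v L
  neighbours-≁ {v} L ¬e = cong length (filter-reject (v ~?_) ¬e)

  -- The invariant of the growth. `C` lists the vertices not yet reached; `cover` also keeps `L` and
  -- `C` disjoint and free of repetitions. Parity refers to degrees inside `L` only.
  record OddPart (p : ℕ) (L C : List (Fin n)) : Set where
    field
      grown   : Grown T p L
      cover   : L ++ C ↭ allFin n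
      linked  : LinkedIn L
      oddPart : ∀ {v} → v ∈ L → neighbours v L % 2 ≡ 1

  -- Inside the new part `x` and `y` have `u` as their only neighbour, the degree of `u` rises by
  -- two, and all other degrees stay the same.
  fork-oddPart : ∀ {p L C D u x y} → OddPart p L C → C ↭ x ∷ y ∷ D → u ∈ L → u ~ x → u ~ y →
    OddPart (suc p) (x ∷ y ∷ L) D
  fork-oddPart {L = L} {C} {D} {u} {x} {y} part C↭ u∈L e f = record
    { grown   = fork grown u∈L e f
    ; cover   = new-cover
    ; linked  = linked-attach (linked-attach linked y∉L u∈L f) (x≢y ∷ x∉L) (there u∈L) e
    ; oddPart = new-odd
    }
    where
    open OddPart part
    new-cover : (x ∷ y ∷ L) ++ D ↭ allFin n
    new-cover = ↭-trans (↭-sym (↭-trans (++⁺ˡ L C↭) (shifts L (x ∷ y ∷ [])))) cover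
    unique : Unique (x ∷ y ∷ L)
    unique = Unique-++⁻ˡ (x ∷ y ∷ L) (Unique-resp-↭ (↭-sym new-cover) (allFin⁺ n))
    x≢y : x ≢ y
    x≢y with (p ∷ _) ∷ _ ← unique = p
    x∉L : All (x ≢_) L
    x∉L with (_ ∷ p) ∷ _ ← unique = p
    y∉L : All (y ≢_) L
    y∉L with _ ∷ p ∷ _ ← unique = p
    uniqueL : Unique L
    uniqueL with _ ∷ _ ∷ p ← unique = p
    ≡u : ∀ {z w} → All (z ≢_) L → u ~ z → w ∈ L → w ~ z → w ≡ u
    ≡u z∉L g w∈L h = entry-unique linked z∉L w∈L u∈L (~-sym h) (~-sym g)
    one : ∀ {z} → All (z ≢_) L → u ~ z → neighbours z L ≡ 1
    one z∉L g = count-unique (_ ~?_) uniqueL u∈L (~-sym g) (λ w∈L h → ≡u z∉L g w∈L (~-sym h))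
    new-odd : ∀ {v} → v ∈ x ∷ y ∷ L → neighbours v (x ∷ y ∷ L) % 2 ≡ 1
    new-odd (here refl) = cong (_% 2) (trans (neighbours-≁ (y ∷ L) irrefl)
      (trans (neighbours-≁ L (siblings-nonadjacent e f)) (one x∉L e)))
    new-odd (there (here refl)) = cong (_% 2) (trans (neighbours-≁ (y ∷ L) (siblings-nonadjacent f e))
      (trans (neighbours-≁ L irrefl) (one y∉L f)))
    new-odd {v} (there (there v∈L)) with v Fin.≟ u
    ... | yes refl = trans (cong (_% 2) (trans (neighbours-~ (y ∷ L) e) (cong suc (neighbours-~ L f))))
      (oddPart v∈L)
    ... | no  v≢u  = trans (cong (_% 2) (trans (neighbours-≁ (y ∷ L) (v≢u ∘ ≡u x∉L e v∈L))
      (neighbours-≁ L (v≢u ∘ ≡u y∉L f v∈L)))) (oddPart v∈L)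

  neighbour : ∀ u → ∃ (u ~_)
  neighbour u with Any.any? (u ~?_) (allFin n)
  ... | yes p with v , _ , e ← find p = v , e
  -- Without a neighbour the degree would be 0, which is even.
  ... | no ¬p with () ←
    trans (sym (cong (λ xs → length xs % 2) (filter-none (u ~?_) (All.¬Any⇒All¬ _ ¬p)))) (odd u)

  edge-oddPart : ∀ u → ∃₂ λ L C → OddPart 0 L C
  edge-oddPart u with v , e ← neighbour u
    with C , all↭ ← ∈⇒↭∷ (∈-allFin u)
    with ∈-resp-↭ all↭ (∈-allFin v)
  ... | here refl = contradiction e irrefl
  ... | there v∈C with D , C↭ ← ∈⇒↭∷ v∈C = u ∷ v ∷ [] , D , record
    { grown   = edge e
    ; cover   = ↭-sym (↭-trans all↭ (prep u C↭))
    ; linked  = linked-attach linked-singleton (~⇒≢ e ∷ []) (here refl) (~-sym e)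
    ; oddPart = λ
        { (here refl)         → cong (_% 2) (trans (neighbours-≁ (v ∷ []) irrefl) (neighbours-~ [] e))
        ; (there (here refl)) → cong (_% 2) (trans (neighbours-~ (v ∷ []) (~-sym e))
                                           (cong suc (neighbours-≁ [] irrefl))) }
    }

  -- The edge sought is the first one along which the walk leaves `L`.
  exit : ∀ {L C} → L ++ C ↭ allFin n → ∀ {k u z} → Walk T k u z → u ∈ L → All (z ≢_) L →
    ∃₂ λ v x → v ∈ L × x ∈ C × v ~ x
  exit         cover []                  u∈L z∉L = contradiction refl (All.lookup z∉L u∈L)
  exit {L} {C} cover (_∷_ {v = v} e p) u∈L z∉L with ∈-++⁻ L (∈-resp-↭ (↭-sym cover) (∈-allFin v))
  ... | inj₁ v∈L = exit cover p v∈L z∉L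
  ... | inj₂ v∈C = _ , _ , u∈L , v∈C , e

  grown-nonempty : ∀ {p L} → Grown T p L → ∃ (_∈ L)
  grown-nonempty (edge _)       = _ , here refl
  grown-nonempty (fork _ _ _ _) = _ , here refl

  -- If `x` were the only neighbour of `u` outside `L`, the degree of `u` in the tree would be one
  -- more than its odd degree inside `L`.
  second : ∀ {p L C D u x} → OddPart p L C → C ↭ x ∷ D → u ∈ L → u ~ x → Any (u ~_) D
  second {L = L} {C} {D} {u} {x} part C↭ u∈L e with Any.any? (u ~?_) D
  ... | yes p = p
  ... | no ¬p = contradiction (trans (cong (_% 2) (sym degree≡)) (odd u))
    (odd⇒suc-even (neighbours u L) (oddPart u∈L))
    where
    open OddPart part
    open ≡-Reasoning
    degree≡ : degree T u ≡ suc (neighbours u L)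
    degree≡ = begin
      degree T u                          ≡⟨ ↭-length (filter-↭ (u ~?_) (↭-trans (↭-sym cover) (++⁺ˡ L C↭))) ⟩
      neighbours u (L ++ x ∷ D)           ≡⟨ ↭-length (filter-↭ (u ~?_) (shift x L D)) ⟩
      neighbours u (x ∷ L ++ D)           ≡⟨ neighbours-~ (L ++ D) e ⟩
      suc (neighbours u (L ++ D))         ≡⟨ cong (suc ∘ length) (filter-++ (u ~?_) L D) ⟩
      suc (length (filter (u ~?_) L ++ filter (u ~?_) D))
        ≡⟨ cong (λ xs → suc (length (filter (u ~?_) L ++ xs))) (filter-none (u ~?_) (All.¬Any⇒All¬ D ¬p)) ⟩
      suc (length (filter (u ~?_) L ++ [])) ≡⟨ cong suc (trans (length-++ (filter (u ~?_) L)) (+-comm _ 0)) ⟩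
      suc (neighbours u L)                ∎

  outside : ∀ {p L z C} → OddPart p L (z ∷ C) → All (z ≢_) L
  outside {L = L} {z} {C} part
    with z∉ ∷ _ ← Unique-resp-↭ (↭-trans (↭-sym (OddPart.cover part)) (shift z L C)) (allFin⁺ n) = All.++⁻ˡ L z∉

  -- The number `f` bounds the length of `C` and makes the recursion structural.
  grow : ∀ f {p L C} → OddPart p L C → length C ≤ f → ∃₂ λ q M → Grown T q M × M ↭ allFin n
  grow f {L = L} {[]} part _ = _ , _ , grown , ↭-trans (↭-reflexive (sym (++-identityʳ L))) cover
    where open OddPart part
  grow (suc size) {L = L} {z ∷ C} part len≤ with u₀ , u₀∈L ← grown-nonempty (OddPart.grown part)
    -- A walk from the part to the remaining vertex `z` has to leave the part.
    with u , x , u∈L , x∈C , e ← exit (OddPart.cover part) (proj₂ (connected u₀ z)) u₀∈L (outside part)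
    with D , C↭ ← ∈⇒↭∷ x∈C
    with y , y∈D , f ← find (second part C↭ u∈L e)
    with E , D↭ ← ∈⇒↭∷ y∈D
    = grow size (fork-oddPart part (↭-trans C↭ (prep x D↭)) u∈L e f)
        -- A fork takes two vertices from `C` while the bound drops by one, so the inequality
        -- obtained is strict and gets weakened.
        (<⇒≤ (s≤s⁻¹ (subst (_≤ suc size) (↭-length (↭-trans C↭ (prep x D↭))) len≤)))

  odd-tree-grown : Fin n → ∃₂ λ p L → Grown T p L × L ↭ allFin n
  odd-tree-grown u with L , C , part ← edge-oddPart u = grow (length C) part ≤-refl

-- Comparison of an odd tree with the caterpillar.

odd-tree-≼ : ∀ {n} → 0 < n → ∀ (T : Graph n) (oddTree : IsOddTree T) →
  distanceSequence (mkConnected T (IsOddTree.connected oddTree)) ≼ distanceSequence T[ n ]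
odd-tree-≼ {n} 0<n T oddTree with p , L , g , L↭ ← odd-tree-grown T oddTree (fromℕ< 0<n) =
  subst (λ m → distanceSequence G ≼
               distanceSequence (mkConnected (Caterpillar.graph m) (Caterpillar.connected m)))
    (sym n/2≡)
    -- Both orders are `2 * suc p`, so the same `bound r p` separates the two counts.
    (distanceSequence-≼ n≡ λ r → ≤-trans (pairs-caterpillar r p) (pairs-grown G g L↭ r))
  where
  G : ConnectedGraph
  G = mkConnected T (IsOddTree.connected oddTree)
  n≡ : n ≡ 2 * suc p
  n≡ = trans (sym (length-tabulate id)) (trans (sym (↭-length L↭)) (length-grown g))
  n/2≡ : n / 2 ≡ suc p
  n/2≡ = trans (cong (_/ 2) (trans n≡ (*-comm 2 (suc p)))) (m*n/n≡m (suc p) 2)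

theorem4 : ∀ (n : ℕ) → 4 ≤ n →
    ∀ (T : Graph n) (oddTree : IsOddTree T) (I : TopologicalIndex) →
    (NondecreasingDistanceBased I → I (mkConnected T (IsOddTree.connected oddTree)) ≤ᴿ I T[ n ]) ×
    (NonincreasingDistanceBased I → I T[ n ] ≤ᴿ I (mkConnected T (IsOddTree.connected oddTree)))
theorem4 n 4≤n T oddTree I =
  (λ (g , I≃g , mono) q l → proj₂ (I≃g T[ n ]) q (nondecreasing-≼ g mono T≼ q (proj₁ (I≃g G) q l))) ,
  (λ (g , I≃g , mono) q l → proj₂ (I≃g G) q (nonincreasing-≼ g mono T≼ q (proj₁ (I≃g T[ n ]) q l)))
  where
  G : ConnectedGraph
  G = mkConnected T (IsOddTree.connected oddTree)
  T≼ : distanceSequence G ≼ distanceSequence T[ n ]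
  T≼ = odd-tree-≼ (≤-trans (s≤s z≤n) 4≤n) T oddTree
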